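{- Let $\mathbb{K}=(K_1,K_2,K_3,I)$ be a triadic formal context and let $\mathcal{T}$ be the system of all trisets of $\mathbb{K}$. Suppose there exist two distinct triconcepts $c_1=(X_1,Y_1,Z_1)$ and $c_2=(X_1,Y_2,Z_2)$ of $\mathbb{K}$ whose common maximal switching generator $s=(X_1\cap X_1,\,Y_1\cap Y_2,\,Z_1\cap Z_2)$ is non-empty (i.e. not all three of its components are empty). Then there is no closure operator associated with $\mathcal{T}$, that is, there is no map $\sigma:\mathcal{T}\to\mathcal{T}$ that is extensive, monotone and idempotent with respect to $\leq$ and whose set of closed elements $\{t\in\mathcal{T}\mid\sigma(t)=t\}$ is exactly the set of triconcepts of $\mathbb{K}$.
   Context: A triadic formal context $\mathbb{K}=(K_1,K_2,K_3,I)$ consists of sets $K_1,K_2,K_3$ and a relation $I\subseteq K_1\times K_2\times K_3$. A triset of $\mathbb{K}$ is a triple $(X,Y,Z)\in 2^{K_1}\times 2^{K_2}\times 2^{K_3}$ with $X\times Y\times Z\subseteq I$ (components may be empty). Triples are ordered by inclusion of their set representations: $(X,Y,Z)\leq(X',Y',Z')$ iff $X\subseteq X'$, $Y\subseteq Y'$ and $Z\subseteq Z'$. A triconcept of $\mathbb{K}$ is a triset that is maximal with respect to $\leq$ among all trisets of $\mathbb{K}$. The maximal switching generator of two distinct triconcepts is their componentwise intersection. -}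

module Defs where

open import Level using (Level; _⊔_; suc)
open import Algebra.Definitions using (IdempotentFun)
open import Data.Product.Base using (Σ; _×_; _,_; proj₁)
open import Data.Product.Relation.Binary.Pointwise.NonDependent using (×-poset)
open import Function.Bundles using (_⇔_)
open import Relation.Binary.Bundles using (Poset)
open import Relation.Binary.Definitions using (Monotonic₁)
import Relation.Binary.Construct.On as On
open import Relation.Nullary.Negation.Core using (¬_)
open import Relation.Unary using (Pred; _∈_; _∩_; Empty)
open import Relation.Unary.Relation.Binary.Subset using (⊆-poset)

module _ {c ℓ₁ ℓ₂} (P : Poset c ℓ₁ ℓ₂) where
  open Poset P

  record IsClosureOperator (σ : Carrier → Carrier) : Set (c ⊔ ℓ₁ ⊔ ℓ₂) where
    field
      extensive  : ∀ x → x ≤ σ x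
      monotone   : Monotonic₁ _≤_ _≤_ σ
      idempotent : IdempotentFun _≈_ σ

  Closed : (Carrier → Carrier) → Pred Carrier ℓ₁
  Closed σ x = σ x ≈ x

record TriadicContext a b c r : Set (suc (a ⊔ b ⊔ c ⊔ r)) where
  field
    K₁ : Set a
    K₂ : Set b
    K₃ : Set c
    I  : K₁ → K₂ → K₃ → Set r

module _ {a b c r : Level} (𝕂 : TriadicContext a b c r) (p : Level) where
  open TriadicContext 𝕂

  -- Triples of subsets, ordered by componentwise inclusion; their equality is
  -- mutual inclusion in each component.
  triplePoset : Poset _ _ _
  triplePoset = ×-poset (⊆-poset K₁ p) (×-poset (⊆-poset K₂ p) (⊆-poset K₃ p))

  Triple : Set (a ⊔ b ⊔ c ⊔ suc p)
  Triple = Pred K₁ p × Pred K₂ p × Pred K₃ p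

module _ {a b c r p : Level} (𝕂 : TriadicContext a b c r) where
  open TriadicContext 𝕂
  open Poset (triplePoset 𝕂 p)

  IsTriset : Pred (Triple 𝕂 p) (a ⊔ b ⊔ c ⊔ r ⊔ p)
  IsTriset (X , Y , Z) = ∀ {x y z} → x ∈ X → y ∈ Y → z ∈ Z → I x y z

  IsTriconcept : Pred (Triple 𝕂 p) (a ⊔ b ⊔ c ⊔ r ⊔ suc p)
  IsTriconcept t = IsTriset t × (∀ u → IsTriset u → t ≤ u → t ≈ u)

  Distinct : Triple 𝕂 p → Triple 𝕂 p → Set (a ⊔ b ⊔ c ⊔ p)
  Distinct t u = ¬ (t ≈ u)

  maximalSwitchingGenerator : Triple 𝕂 p → Triple 𝕂 p → Triple 𝕂 p
  maximalSwitchingGenerator (X , Y , Z) (X′ , Y′ , Z′) = X ∩ X′ , Y ∩ Y′ , Z ∩ Z′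

  -- At least one component is inhabited, in the negative form.
  NonEmpty : Pred (Triple 𝕂 p) (a ⊔ b ⊔ c ⊔ p)
  NonEmpty (X , Y , Z) = ¬ (Empty X × Empty Y × Empty Z)

module _ {a b c r : Level} (𝕂 : TriadicContext a b c r) (p : Level) where

  Triset : Set (a ⊔ b ⊔ c ⊔ r ⊔ suc p)
  Triset = Σ (Triple 𝕂 p) (IsTriset 𝕂)

  -- The order and equality of trisets ignore the proof of being a triset.
  trisetPoset : Poset _ _ _
  trisetPoset = On.poset {B = Triset} (triplePoset 𝕂 p) proj₁

  record TrisetClosureOperator : Set (a ⊔ b ⊔ c ⊔ r ⊔ suc p) where
    field
      σ                   : Triset → Triset
      isClosureOperator   : IsClosureOperator trisetPoset σ
      closed⇔isTriconcept : ∀ t → Closed trisetPoset σ t ⇔ IsTriconcept 𝕂 (proj₁ t)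

{-# OPTIONS --safe #-}
module Submission where

open import Defs
open import Data.Product.Base using (_,_; proj₁; proj₂)
open import Function.Bundles using (module Equivalence)
open import Level using (Level)
open import Relation.Binary.Bundles using (Poset)
open import Relation.Nullary.Negation.Core using (¬_)
open import Relation.Unary using (Pred)

-- The closed elements of a closure operator are stable under binary meets, whereas triconcepts,
-- being maximal, form an antichain. Trisets are downward closed among triples, so the componentwise
-- intersection of two triconcepts is a triset and is their meet. If the closed trisets were exactly
-- the triconcepts, this meet would be a triconcept below both, hence equal to both, and the two
-- could not be distinct.

module _ {c ℓ₁ ℓ₂ : Level} (P : Poset c ℓ₁ ℓ₂) where
  open Poset P

  -- By monotonicity `σ m` lies below `σ x ≈ x` and `σ y ≈ y`, so it is a lower bound of `x` and `y`
  -- and hence below `m`; extensivity gives the converse.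
  meet-closed : ∀ {σ x y m} → IsClosureOperator P σ →
                m ≤ x → m ≤ y → (∀ {z} → z ≤ x → z ≤ y → z ≤ m) →
                Closed P σ x → Closed P σ y → Closed P σ m
  meet-closed isClosure m≤x m≤y greatest σx≈x σy≈y =
    antisym (greatest (trans (monotone m≤x) (reflexive σx≈x))
                      (trans (monotone m≤y) (reflexive σy≈y)))
            (extensive _)
    where open IsClosureOperator isClosure

module _ {a b c r p : Level} (𝕂 : TriadicContext a b c r) where
  open Poset (triplePoset 𝕂 p)

  infixl 7 _⊓_
  _⊓_ : Triple 𝕂 p → Triple 𝕂 p → Triple 𝕂 p
  _⊓_ = maximalSwitchingGenerator 𝕂

  ⊓-lowerˡ : ∀ t u → t ⊓ u ≤ t
  ⊓-lowerˡ t u = proj₁ , proj₁ , proj₁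

  ⊓-lowerʳ : ∀ t u → t ⊓ u ≤ u
  ⊓-lowerʳ t u = proj₂ , proj₂ , proj₂

  ⊓-greatest : ∀ {t u v} → v ≤ t → v ≤ u → v ≤ t ⊓ u
  ⊓-greatest (f , g , h) (f′ , g′ , h′) =
    (λ x → f x , f′ x) , (λ y → g y , g′ y) , (λ z → h z , h′ z)

  IsTriset-anti-mono : ∀ {t u} → t ≤ u → IsTriset 𝕂 u → IsTriset 𝕂 t
  IsTriset-anti-mono (f , g , h) u-triset x y z = u-triset (f x) (g y) (h z)

  IsTriconcept-antichain : ∀ {t u} → IsTriconcept 𝕂 t → IsTriconcept 𝕂 u → t ≤ u → t ≈ u
  IsTriconcept-antichain (_ , maximal) (u-triset , _) = maximal _ u-triset

  module _ (C : TrisetClosureOperator 𝕂 p) where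
    open TrisetClosureOperator C

    -- The correspondence between closed trisets and triconcepts is used in both directions, with
    -- `meet-closed` in between.
    ⊓-isTriconcept : ∀ {t u} → IsTriconcept 𝕂 t → IsTriconcept 𝕂 u → IsTriconcept 𝕂 (t ⊓ u)
    ⊓-isTriconcept {t} {u} ct@(t-triset , _) cu@(u-triset , _) =
      Equivalence.to (closed⇔isTriconcept m)
        (meet-closed (trisetPoset 𝕂 p) {x = t′} {y = u′} {m = m} isClosureOperator
          -- Trisets inherit their order from triples, so the meet laws for triples apply unchanged.
          (⊓-lowerˡ t u) (⊓-lowerʳ t u) ⊓-greatest
          (Equivalence.from (closed⇔isTriconcept t′) ct)
          (Equivalence.from (closed⇔isTriconcept u′) cu))
      where
      t′ u′ m : Triset 𝕂 p
      t′ = t , t-triset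
      u′ = u , u-triset
      m  = t ⊓ u , IsTriset-anti-mono (⊓-lowerˡ t u) t-triset

    -- The maximality of `t ⊓ u` itself, applied to the larger trisets `t` and `u`, makes it equal
    -- to each of them.
    triconcepts-equal : ∀ {t u} → IsTriconcept 𝕂 t → IsTriconcept 𝕂 u → t ≈ u
    triconcepts-equal {t} {u} ct cu =
      Eq.trans (Eq.sym (IsTriconcept-antichain cm ct (⊓-lowerˡ t u)))
               (IsTriconcept-antichain cm cu (⊓-lowerʳ t u))
      where cm = ⊓-isTriconcept ct cu

theorem4 :
    ∀ {a b c r p} (𝕂 : TriadicContext a b c r) →
    let open TriadicContext 𝕂 in
    (X₁ : Pred K₁ p) (Y₁ Y₂ : Pred K₂ p) (Z₁ Z₂ : Pred K₃ p) →
    let c₁ = (X₁ , Y₁ , Z₁)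
        c₂ = (X₁ , Y₂ , Z₂) in
    IsTriconcept 𝕂 c₁ → IsTriconcept 𝕂 c₂ → Distinct 𝕂 c₁ c₂ →
    NonEmpty 𝕂 (maximalSwitchingGenerator 𝕂 c₁ c₂) →
    ¬ TrisetClosureOperator 𝕂 p
theorem4 𝕂 _ _ _ _ _ isC₁ isC₂ c₁≉c₂ _ C = c₁≉c₂ (triconcepts-equal 𝕂 C isC₁ isC₂)
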